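{- For the Proportional Online Unbounded Knapsack Problem with Removal, the (strict) competitive ratio of the deterministic online algorithm Simple is at most $3/2$.
   Context: Problem. An instance of the Online Unbounded Knapsack Problem with Removal is a finite sequence of items $I=(x_1,\dots,x_n)$, where an item $x=(w,v)$ has a weight $w(x)=w\in(0,1]$ and a value $v(x)=v\in\mathbb{R}_{>0}$. A solution is a finite multiset $S$ of items from $I$ (each item may appear arbitrarily often) with $\sum_{x\in S}w(x)\le 1$; its gain is $v(S)=\sum_{x\in S}v(x)$. $\mathrm{Opt}(I)$ denotes a solution to $I$ of maximum gain. In the proportional variant, every item satisfies $w(x)=v(x)$, and an item $x$ is identified with this number, $x=w(x)=v(x)\in(0,1]$. Online algorithms. An online algorithm maintains a solution $S$ ("knapsack"), initially empty. Items arrive one by one in order; when an item $x$ arrives, the algorithm, knowing only the items received so far, may add any number of copies of $x$ to $S$ and then remove an arbitrary sub-multiset from $S$, such that $S$ is again a valid solution. $\mathrm{Alg}(I)$ denotes the solution held by the algorithm after all of $I$ has been processed. Competitive ratio. A deterministic algorithm Alg is (strictly) $c$-competitive, for a constant $c\ge 1$, if $c\cdot v(\mathrm{Alg}(I))\ge v(\mathrm{Opt}(I))$ for every instance $I$. Its (strict) competitive ratio is the infimum of all $c\ge1$ for which it is $c$-competitive. Notation. $\mathrm{fill}(x)$ is the multiset consisting of $\lfloor 1/w(x)\rfloor$ copies of $x$. Algorithm Simple. Start with $K=\emptyset$. For each arriving item $x$: if $x\le 1/2$, set $K=\mathrm{fill}(x)$ (removing everything previously packed) and ignore all further items; otherwise,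 if $K=\emptyset$, set $K=\{x\}$; otherwise, if $K=\{x'\}$ and $x>x'$, set $K=\{x\}$; otherwise leave $K$ unchanged. The output is $K$. -}

module Defs where

open import Algebra.Bundles using (CommutativeRing)
open import Algebra.Core using (Op₁; Op₂)
open import Algebra.Structures using (IsCommutativeRing)
import Algebra.Properties.Ring as RingProperties
import Algebra.Properties.Semiring.Mult as SemiringMult
open import Data.Bool.Base using (Bool; true; false)
open import Data.List.Base using (List; []; _∷_; _++_; [_]; _∷ʳ_; foldl; foldr; map; replicate)
open import Data.List.Membership.Propositional using (_∈_)
open import Data.List.Properties using (foldl-∷ʳ; ++-identityʳ)
open import Data.List.Relation.Binary.Permutation.Propositional using (_↭_; ↭-refl; ↭-reflexive)
open import Data.List.Relation.Unary.All using (All)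
open import Data.Nat.Base using (ℕ; zero; suc)
open import Data.Product.Base using (_×_; _,_; ∃; proj₁; proj₂)
open import Data.Sum.Base using (inj₁; inj₂)
open import Level using (0ℓ)
open import Relation.Binary.Bundles using (DecTotalOrder)
open import Relation.Binary.Core using (Rel)
import Relation.Binary.Construct.NonStrictToStrict as ToStrict
open import Relation.Binary.Definitions using (Decidable)
open import Relation.Binary.PropositionalEquality.Core as ≡ using (_≡_)
import Relation.Binary.Reasoning.Setoid as SetoidReasoning
open import Relation.Binary.Structures using (IsDecTotalOrder)
open import Relation.Nullary.Decidable.Core using (yes; no)
open import Relation.Nullary.Negation.Core using (¬_)

------------------------------------------------------------------------
-- Real numbers

-- ℝ, axiomatised classically as the complete ordered field: the order is
-- decidable and suprema exist for arbitrary predicates. Classically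
-- `archimedean` follows from `supremum`; it is a separate axiom so that the
-- floor function is computable from it.
record RealNumbers : Set₁ where
  infix  8 -_
  infixl 7 _*_
  infixl 6 _+_
  infix  4 _≈_ _≤_ _≉_
  field
    Carrier           : Set
    _≈_               : Rel Carrier 0ℓ
    _≤_               : Rel Carrier 0ℓ
    _+_               : Op₂ Carrier
    _*_               : Op₂ Carrier
    -_                : Op₁ Carrier
    0#                : Carrier
    1#                : Carrier
    isCommutativeRing : IsCommutativeRing _≈_ _+_ _*_ -_ 0# 1#
    isDecTotalOrder   : IsDecTotalOrder _≈_ _≤_

  commutativeRing : CommutativeRing 0ℓ 0ℓ
  commutativeRing = record { isCommutativeRing = isCommutativeRing }

  decTotalOrder : DecTotalOrder 0ℓ 0ℓ 0ℓ
  decTotalOrder = record { isDecTotalOrder = isDecTotalOrder }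

  open SemiringMult (CommutativeRing.semiring commutativeRing) public
    using () renaming (_×_ to _·_)
  open ToStrict _≈_ _≤_ public
    using (_<_)

  _≉_ : Rel Carrier 0ℓ
  x ≉ y = ¬ (x ≈ y)

  UpperBound : (Carrier → Set) → Carrier → Set
  UpperBound P b = ∀ x → P x → x ≤ b

  LowerBound : (Carrier → Set) → Carrier → Set
  LowerBound P b = ∀ x → P x → b ≤ x

  Supremum : (Carrier → Set) → Carrier → Set
  Supremum P s = UpperBound P s × (∀ b → UpperBound P b → s ≤ b)

  Infimum : (Carrier → Set) → Carrier → Set
  Infimum P s = LowerBound P s × (∀ b → LowerBound P b → b ≤ s)

  field
    0≉1         : 0# ≉ 1#
    inverse     : ∀ x → x ≉ 0# → ∃ λ y → x * y ≈ 1#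
    +-monoˡ-≤   : ∀ z {x y} → x ≤ y → x + z ≤ y + z
    *-nonneg    : ∀ {x y} → 0# ≤ x → 0# ≤ y → 0# ≤ x * y
    archimedean : ∀ x → ∃ λ n → x ≤ n · 1#
    supremum    : (P : Carrier → Set) → ∃ P → ∃ (UpperBound P) → ∃ (Supremum P)

module Reals (ℝ : RealNumbers) where
  open RealNumbers ℝ public
  open CommutativeRing commutativeRing
    using ( setoid; ring; semiring; sym; trans; +-congˡ; +-assoc
          ; +-identityˡ; +-identityʳ; -‿cong; -‿inverseˡ; -‿inverseʳ; *-comm; *-congˡ
          ; *-congʳ; *-assoc; *-identityˡ; distribʳ)
  open RingProperties ring using (-‿distribˡ-*; -‿distribʳ-*; -‿involutive)
  open SemiringMult semiring using (×-assoc-*; ×-congʳ)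
  open DecTotalOrder decTotalOrder public
    using (_≟_; _≤?_)
  open DecTotalOrder decTotalOrder
    using (total; antisym)
    renaming (reflexive to ≤-reflexive; trans to ≤-trans)
  open SetoidReasoning setoid

  _<?_ : Decidable _<_
  _<?_ = ToStrict.<-decidable _≈_ _≤_ _≟_ _≤?_

  neg-nonneg : ∀ {x} → x ≤ 0# → 0# ≤ - x
  neg-nonneg {x} x≤0 =
    ≤-trans (≤-reflexive (sym (-‿inverseʳ x)))
      (≤-trans (+-monoˡ-≤ (- x) x≤0) (≤-reflexive (+-identityˡ (- x))))

  -x*-x≈x*x : ∀ x → - x * - x ≈ x * x
  -x*-x≈x*x x = begin
    - x * - x      ≈⟨ -‿distribˡ-* x (- x) ⟨
    - (x * - x)    ≈⟨ -‿cong (-‿distribʳ-* x x) ⟨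
    - (- (x * x))  ≈⟨ -‿involutive (x * x) ⟩
    x * x          ∎

  square-nonneg : ∀ x → 0# ≤ x * x
  square-nonneg x with total 0# x
  ... | inj₁ 0≤x = *-nonneg 0≤x 0≤x
  ... | inj₂ x≤0 =
    ≤-trans (*-nonneg (neg-nonneg x≤0) (neg-nonneg x≤0)) (≤-reflexive (-x*-x≈x*x x))

  0≤1 : 0# ≤ 1#
  0≤1 = ≤-trans (square-nonneg 1#) (≤-reflexive (*-identityˡ 1#))

  2≉0 : 2 · 1# ≉ 0#
  2≉0 2≈0 = 0≉1 (antisym 0≤1 (≤-trans 1≤2 (≤-reflexive 2≈0)))
    where
    1≤2 : 1# ≤ 2 · 1#
    1≤2 = ≤-trans (≤-reflexive (sym (+-identityˡ 1#)))
            (≤-trans (+-monoˡ-≤ 1# 0≤1) (≤-reflexive (+-congˡ (sym (+-identityʳ 1#)))))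

  *-monoʳ-≤ : ∀ {x y z} → 0# ≤ z → x ≤ y → x * z ≤ y * z
  *-monoʳ-≤ {x} {y} {z} 0≤z x≤y =
    ≤-trans (≤-reflexive (sym (+-identityˡ (x * z))))
      (≤-trans (+-monoˡ-≤ (x * z) (*-nonneg 0≤y-x 0≤z)) (≤-reflexive [y-x]z+xz≈yz))
    where
    0≤y-x : 0# ≤ y + - x
    0≤y-x = ≤-trans (≤-reflexive (sym (-‿inverseʳ x))) (+-monoˡ-≤ (- x) x≤y)

    [y-x]z+xz≈yz : (y + - x) * z + x * z ≈ y * z
    [y-x]z+xz≈yz = begin
      (y + - x) * z + x * z  ≈⟨ distribʳ z (y + - x) x ⟨
      (y + - x + x) * z      ≈⟨ *-congʳ (+-assoc y (- x) x) ⟩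
      (y + (- x + x)) * z    ≈⟨ *-congʳ (+-congˡ (-‿inverseˡ x)) ⟩
      (y + 0#) * z           ≈⟨ *-congʳ (+-identityʳ y) ⟩
      y * z                  ∎

  1/2 : Carrier
  1/2 = proj₁ (inverse (2 · 1#) 2≉0)

  3/2 : Carrier
  3/2 = 3 · 1# * 1/2

  1/_ : ∃ (0# <_) → Carrier
  1/ (x , _ , 0≉x) = proj₁ (inverse x (λ x≈0 → 0≉x (sym x≈0)))

  1/-inverseʳ : ∀ x 0<x → x * 1/ (x , 0<x) ≈ 1#
  1/-inverseʳ x (_ , 0≉x) = proj₂ (inverse x (λ x≈0 → 0≉x (sym x≈0)))

  1/-nonneg : ∀ x 0<x → 0# ≤ 1/ (x , 0<x)
  1/-nonneg x 0<x = ≤-trans (*-nonneg (proj₁ 0<x) (square-nonneg y)) (≤-reflexive x*y²≈y)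
    where
    y = 1/ (x , 0<x)

    x*y²≈y : x * (y * y) ≈ y
    x*y²≈y = begin
      x * (y * y)  ≈⟨ *-assoc x y y ⟨
      x * y * y    ≈⟨ *-congʳ (1/-inverseʳ x 0<x) ⟩
      1# * y       ≈⟨ *-identityˡ y ⟩
      y            ∎

  -- The greatest n ≤ N with n ≤ x, or 0 if there is none.
  floorUpTo : ℕ → Carrier → ℕ
  floorUpTo zero    x = zero
  floorUpTo (suc N) x with (suc N · 1#) ≤? x
  ... | yes _ = suc N
  ... | no  _ = floorUpTo N x

  -- The floor function, for nonnegative arguments only.
  ⌊_⌋ : Carrier → ℕ
  ⌊ x ⌋ = floorUpTo (proj₁ (archimedean x)) x

  ⌊x⌋≤x : ∀ {x} → 0# ≤ x → ⌊ x ⌋ · 1# ≤ x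
  ⌊x⌋≤x {x} 0≤x = go (proj₁ (archimedean x))
    where
    go : ∀ N → floorUpTo N x · 1# ≤ x
    go zero = 0≤x
    go (suc N) with (suc N · 1#) ≤? x
    ... | yes 1+N≤x = 1+N≤x
    ... | no  _     = go N

  ⌊1/x⌋·x≤1 : ∀ x 0<x → ⌊ 1/ (x , 0<x) ⌋ · x ≤ 1#
  ⌊1/x⌋·x≤1 x 0<x =
    ≤-trans (≤-reflexive n·x≈[n·1]x)
      (≤-trans (*-monoʳ-≤ (proj₁ 0<x) (⌊x⌋≤x (1/-nonneg x 0<x)))
        (≤-reflexive (trans (*-comm _ x) (1/-inverseʳ x 0<x))))
    where
    n = ⌊ 1/ (x , 0<x) ⌋

    n·x≈[n·1]x : n · x ≈ n · 1# * x
    n·x≈[n·1]x = begin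
      n · x         ≈⟨ ×-congʳ n (*-identityˡ x) ⟨
      n · (1# * x)  ≈⟨ ×-assoc-* n 1# x ⟨
      n · 1# * x    ∎

------------------------------------------------------------------------
-- Proportional online unbounded knapsack with removal

module Knapsack (ℝ : RealNumbers) where
  open Reals ℝ

  -- `size` is both the weight and the value.
  record Item : Set where
    constructor item
    field
      size   : Carrier
      0<size : 0# < size
      size≤1 : size ≤ 1#

  open Item public

  Instance : Set
  Instance = List Item

  -- Lists stand for finite multisets; their order is irrelevant.
  Packing : Set
  Packing = List Item

  weight : Packing → Carrier
  weight S = foldr _+_ 0# (map size S)

  gain : Packing → Carrier
  gain S = foldr _+_ 0# (map size S)

  Valid : Packing → Set
  Valid S = weight S ≤ 1#

  IsSolution : Instance → Packing → Set
  IsSolution I S = All (_∈ I) S × Valid S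

  IsOptimal : Instance → Packing → Set
  IsOptimal I S = IsSolution I S × (∀ T → IsSolution I T → gain T ≤ gain S)

  infix 4 _⊆ₘ_
  _⊆ₘ_ : Packing → Packing → Set
  S ⊆ₘ T = ∃ λ R → S ++ R ↭ T

  -- `knapsack I` is the packing held once exactly the items of I have arrived.
  record OnlineAlgorithm : Set where
    field
      knapsack : Instance → Packing
      initial  : knapsack [] ≡ []
      step     : ∀ I x → ∃ λ k → knapsack (I ∷ʳ x) ⊆ₘ replicate k x ++ knapsack I
      valid    : ∀ I → Valid (knapsack I)

  open OnlineAlgorithm public

  Competitive : OnlineAlgorithm → Carrier → Set
  Competitive A c = ∀ I Opt → IsOptimal I Opt → gain Opt ≤ c * gain (knapsack A I)

  IsCompetitiveRatio : OnlineAlgorithm → Carrier → Set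
  IsCompetitiveRatio A = Infimum (λ c → 1# ≤ c × Competitive A c)

  fill : Item → Packing
  fill x = replicate ⌊ 1/ (size x , 0<size x) ⌋ x

  -- The flag records that all further items are ignored.
  simpleStep : Packing × Bool → Item → Packing × Bool
  simpleStep (K , true)  x = K , true
  simpleStep (K , false) x with size x ≤? 1/2
  simpleStep (K , false)          x | yes _ = fill x , true
  simpleStep ([] , false)         x | no  _ = [ x ] , false
  simpleStep (x′ ∷ [] , false)    x | no  _ with size x′ <? size x
  ... | yes _ = [ x ] , false
  ... | no  _ = [ x′ ] , false
  simpleStep (K@(_ ∷ _ ∷ _) , false) x | no _ = K , false

  simpleRun : Instance → Packing × Bool
  simpleRun = foldl simpleStep ([] , false)

  open CommutativeRing commutativeRing using (+-identityʳ)
  open DecTotalOrder decTotalOrder using () renaming (reflexive to ≤-reflexive; trans to ≤-trans)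

  weight-replicate : ∀ n x → weight (replicate n x) ≡ n · size x
  weight-replicate zero    x = ≡.refl
  weight-replicate (suc n) x = ≡.cong (size x +_) (weight-replicate n x)

  fill-valid : ∀ x → Valid (fill x)
  fill-valid x = ≡.subst (_≤ 1#) (≡.sym (weight-replicate ⌊ 1/ (size x , 0<size x) ⌋ x))
                   (⌊1/x⌋·x≤1 (size x) (0<size x))

  [x]-valid : ∀ x → Valid [ x ]
  [x]-valid x = ≤-trans (≤-reflexive (+-identityʳ (size x))) (size≤1 x)

  keep : ∀ K (x : Item) → ∃ λ k → K ⊆ₘ replicate k x ++ K
  keep K x = 0 , [] , ↭-reflexive (++-identityʳ K)

  simpleStep-⊆ₘ : ∀ s x → ∃ λ k → proj₁ (simpleStep s x) ⊆ₘ replicate k x ++ proj₁ s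
  simpleStep-⊆ₘ (K , true)  x = keep K x
  simpleStep-⊆ₘ (K , false) x with size x ≤? 1/2
  simpleStep-⊆ₘ (K , false)       x | yes _ = _ , K , ↭-refl
  simpleStep-⊆ₘ ([] , false)      x | no  _ = 1 , [] , ↭-refl
  simpleStep-⊆ₘ (x′ ∷ [] , false) x | no  _ with size x′ <? size x
  ... | yes _ = 1 , [ x′ ] , ↭-refl
  ... | no  _ = keep [ x′ ] x
  simpleStep-⊆ₘ (K@(_ ∷ _ ∷ _) , false) x | no _ = keep K x

  simpleStep-valid : ∀ s x → Valid (proj₁ s) → Valid (proj₁ (simpleStep s x))
  simpleStep-valid (K , true)  x v = v
  simpleStep-valid (K , false) x v with size x ≤? 1/2
  simpleStep-valid (K , false)       x v | yes _ = fill-valid x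
  simpleStep-valid ([] , false)      x v | no  _ = [x]-valid x
  simpleStep-valid (x′ ∷ [] , false) x v | no  _ with size x′ <? size x
  ... | yes _ = [x]-valid x
  ... | no  _ = v
  simpleStep-valid (K@(_ ∷ _ ∷ _) , false) x v | no _ = v

  foldl-valid : ∀ I s → Valid (proj₁ s) → Valid (proj₁ (foldl simpleStep s I))
  foldl-valid []      s v = v
  foldl-valid (x ∷ I) s v = foldl-valid I (simpleStep s x) (simpleStep-valid s x v)

  Simple : OnlineAlgorithm
  Simple = record
    { knapsack = λ I → proj₁ (simpleRun I)
    ; initial  = ≡.refl
    ; step     = λ I x → ≡.subst (λ s → ∃ λ k → proj₁ s ⊆ₘ replicate k x ++ proj₁ (simpleRun I))
                   (≡.sym (foldl-∷ʳ simpleStep ([] , false) x I))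
                   (simpleStep-⊆ₘ (simpleRun I) x)
    ; valid    = λ I → foldl-valid I ([] , false) 0≤1
    }

{-# OPTIONS --safe #-}

-- If some item x ≤ 1/2 arrives, Simple ends with n = ⌊1/x⌋ ≥ 2 copies of the
-- first such x, so 3/2 · nx = nx + nx/2 ≥ (n + 1)x ≥ 1. Otherwise every
-- solution has at most one item, and Simple holds the largest one.
-- The competitive ratio itself exists as the supremum of the lower bounds of
-- the set of admissible constants, which is bounded above by its member 3/2.
module Submission where

open import Defs
open import Algebra.Bundles using (CommutativeRing)
import Algebra.Properties.Semiring.Mult as SemiringMult
open import Data.Bool.Base using (true; false)
open import Data.Empty using (⊥-elim)
open import Data.List.Base using ([]; _∷_; [_]; foldl)
open import Data.List.Relation.Unary.All as All using (All; []; _∷_)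
open import Data.Nat.Base as ℕ using (zero; suc; z≤n; s≤s)
import Data.Nat.Properties as ℕ
open import Data.Product using (∃; _×_; _,_; proj₁; proj₂)
open import Data.Sum.Base using (_⊎_; inj₁; inj₂)
open import Relation.Binary.Bundles using (DecTotalOrder)
import Relation.Binary.Properties.DecTotalOrder as DecTotalOrderProperties
import Relation.Binary.Reasoning.PartialOrder as ≤-Reasoning
open import Relation.Binary.PropositionalEquality.Core as ≡ using (_≡_)
open import Relation.Nullary.Decidable.Core using (yes; no)
open import Relation.Nullary.Negation.Core using (¬_)

module OrderedField (ℝ : RealNumbers) where
  open Reals ℝ
  open CommutativeRing commutativeRing
    using ( semiring; sym; trans; +-comm; +-cong; +-congˡ; +-congʳ; +-assoc
          ; +-identityˡ; +-identityʳ; -‿inverseʳ; *-comm; *-congˡ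
          ; *-congʳ; *-assoc; *-identityˡ; *-identityʳ; distribʳ)
  open SemiringMult semiring using (×-assoc-*; ×-congʳ)
  open DecTotalOrder decTotalOrder public
    using ()
    renaming ( refl to ≤-refl; reflexive to ≤-reflexive; trans to ≤-trans
             ; antisym to ≤-antisym; total to ≤-total)
  open DecTotalOrderProperties decTotalOrder public using (≮⇒≥)
  open ≤-Reasoning (DecTotalOrder.poset decTotalOrder)

  -- Order, addition and natural multiples.

  ≰⇒≥ : ∀ {x y} → ¬ (x ≤ y) → y ≤ x
  ≰⇒≥ {x} {y} x≰y with ≤-total x y
  ... | inj₁ x≤y = ⊥-elim (x≰y x≤y)
  ... | inj₂ y≤x = y≤x

  1≰0 : ¬ (1# ≤ 0#)
  1≰0 1≤0 = 0≉1 (≤-antisym 0≤1 1≤0)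

  +-monoʳ-≤ : ∀ z {x y} → x ≤ y → z + x ≤ z + y
  +-monoʳ-≤ z {x} {y} x≤y = begin
    z + x  ≈⟨ +-comm z x ⟩
    x + z  ≤⟨ +-monoˡ-≤ z x≤y ⟩
    y + z  ≈⟨ +-comm y z ⟩
    z + y  ∎

  +-cancelʳ-≤ : ∀ z {x y} → x + z ≤ y + z → x ≤ y
  +-cancelʳ-≤ z {x} {y} x+z≤y+z = begin
    x              ≈⟨ cancel x ⟨
    x + z + - z    ≤⟨ +-monoˡ-≤ (- z) x+z≤y+z ⟩
    y + z + - z    ≈⟨ cancel y ⟩
    y              ∎
    where
    cancel : ∀ w → w + z + - z ≈ w
    cancel w = trans (+-assoc w z (- z)) (trans (+-congˡ (-‿inverseʳ z)) (+-identityʳ w))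

  x≤x+y : ∀ x {y} → 0# ≤ y → x ≤ x + y
  x≤x+y x {y} 0≤y = begin
    x       ≈⟨ +-identityʳ x ⟨
    x + 0#  ≤⟨ +-monoʳ-≤ x 0≤y ⟩
    x + y   ∎

  *-monoˡ-≤ : ∀ {x y z} → 0# ≤ z → x ≤ y → z * x ≤ z * y
  *-monoˡ-≤ {x} {y} {z} 0≤z x≤y = begin
    z * x  ≈⟨ *-comm z x ⟩
    x * z  ≤⟨ *-monoʳ-≤ 0≤z x≤y ⟩
    y * z  ≈⟨ *-comm y z ⟩
    z * y  ∎

  n·1*x≈n·x : ∀ n x → n · 1# * x ≈ n · x
  n·1*x≈n·x n x = trans (×-assoc-* n 1# x) (×-congʳ n (*-identityˡ x))

  ·-nonneg : ∀ n {x} → 0# ≤ x → 0# ≤ n · x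
  ·-nonneg zero        0≤x = ≤-refl
  ·-nonneg (suc n) {x} 0≤x = ≤-trans 0≤x (x≤x+y x (·-nonneg n 0≤x))

  ·-monoˡ-≤ : ∀ {m n x} → 0# ≤ x → m ℕ.≤ n → m · x ≤ n · x
  ·-monoˡ-≤ {n = n} 0≤x z≤n       = ·-nonneg n 0≤x
  ·-monoˡ-≤ {x = x} 0≤x (s≤s m≤n) = +-monoʳ-≤ x (·-monoˡ-≤ 0≤x m≤n)

  -- The constants 1/2 and 3/2.

  2·1*1/2≈1 : 2 · 1# * 1/2 ≈ 1#
  2·1*1/2≈1 = proj₂ (inverse (2 · 1#) 2≉0)

  1/2*2·x≈x : ∀ x → 1/2 * (2 · x) ≈ x
  1/2*2·x≈x x = begin-equality
    1/2 * (2 · x)       ≈⟨ *-congˡ (n·1*x≈n·x 2 x) ⟨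
    1/2 * (2 · 1# * x)  ≈⟨ *-assoc 1/2 (2 · 1#) x ⟨
    1/2 * 2 · 1# * x    ≈⟨ *-congʳ (trans (*-comm 1/2 (2 · 1#)) 2·1*1/2≈1) ⟩
    1# * x              ≈⟨ *-identityˡ x ⟩
    x                   ∎

  1≈1/2+1/2 : 1# ≈ 1/2 + 1/2
  1≈1/2+1/2 = begin-equality
    1#               ≈⟨ 2·1*1/2≈1 ⟨
    2 · 1# * 1/2     ≈⟨ n·1*x≈n·x 2 1/2 ⟩
    1/2 + (1/2 + 0#) ≈⟨ +-congˡ (+-identityʳ 1/2) ⟩
    1/2 + 1/2        ∎

  -- `inverse` says nothing about signs, so the sign is decided by totality: a nonpositive half
  -- would make its double, which is 1, nonpositive.
  0≤1/2 : 0# ≤ 1/2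
  0≤1/2 with ≤-total 0# 1/2
  ... | inj₁ 0≤1/2 = 0≤1/2
  ... | inj₂ 1/2≤0 = ⊥-elim (1≰0 (begin
    1#         ≈⟨ 1≈1/2+1/2 ⟩
    1/2 + 1/2  ≤⟨ +-monoˡ-≤ 1/2 1/2≤0 ⟩
    0# + 1/2   ≈⟨ +-identityˡ 1/2 ⟩
    1/2        ≤⟨ 1/2≤0 ⟩
    0#         ∎))

  3/2≈1+1/2 : 3/2 ≈ 1# + 1/2
  3/2≈1+1/2 = begin-equality
    (1# + 2 · 1#) * 1/2        ≈⟨ distribʳ 1/2 1# (2 · 1#) ⟩
    1# * 1/2 + 2 · 1# * 1/2    ≈⟨ +-cong (*-identityˡ 1/2) 2·1*1/2≈1 ⟩
    1/2 + 1#                   ≈⟨ +-comm 1/2 1# ⟩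
    1# + 1/2                   ∎

  3/2*x≈x+1/2*x : ∀ x → 3/2 * x ≈ x + 1/2 * x
  3/2*x≈x+1/2*x x = begin-equality
    3/2 * x            ≈⟨ *-congʳ 3/2≈1+1/2 ⟩
    (1# + 1/2) * x     ≈⟨ distribʳ x 1# 1/2 ⟩
    1# * x + 1/2 * x   ≈⟨ +-congʳ (*-identityˡ x) ⟩
    x + 1/2 * x        ∎

  1≤3/2 : 1# ≤ 3/2
  1≤3/2 = ≤-trans (x≤x+y 1# 0≤1/2) (≤-reflexive (sym 3/2≈1+1/2))

  x≤3/2*x : ∀ {x} → 0# ≤ x → x ≤ 3/2 * x
  x≤3/2*x {x} 0≤x = begin
    x            ≤⟨ x≤x+y x (*-nonneg 0≤1/2 0≤x) ⟩
    x + 1/2 * x  ≈⟨ 3/2*x≈x+1/2*x x ⟨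
    3/2 * x      ∎

  -- Floors and reciprocals.

  1+⌊x⌋≰x : ∀ x → ¬ (suc ⌊ x ⌋ · 1# ≤ x)
  1+⌊x⌋≰x x = go N 1+N≰x
    where
    N = proj₁ (archimedean x)

    1+N≰x : ¬ (suc N · 1# ≤ x)
    1+N≰x 1+N≤x = 1≰0 (+-cancelʳ-≤ (N · 1#) (begin
      1# + N · 1#  ≤⟨ 1+N≤x ⟩
      x            ≤⟨ proj₂ (archimedean x) ⟩
      N · 1#       ≈⟨ +-identityˡ (N · 1#) ⟨
      0# + N · 1#  ∎))

    -- The downward search keeps the invariant that the successor of the current candidate exceeds
    -- `x`. The Archimedean bound supplies it at `N`, and each failed test supplies it one step
    -- lower, down to the default 0.
    go : ∀ M → ¬ (suc M · 1# ≤ x) → ¬ (suc (floorUpTo M x) · 1# ≤ x)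
    go zero    1+M≰x = 1+M≰x
    go (suc M) 1+M≰x with (suc M · 1#) ≤? x
    ... | yes _   = 1+M≰x
    ... | no  M≰x = go M M≰x

  n≤x⇒n≤⌊x⌋ : ∀ n {x} → n · 1# ≤ x → n ℕ.≤ ⌊ x ⌋
  n≤x⇒n≤⌊x⌋ n {x} n≤x =
    ℕ.≮⇒≥ λ ⌊x⌋<n → 1+⌊x⌋≰x x (≤-trans (·-monoˡ-≤ 0≤1 ⌊x⌋<n) n≤x)

  x≤1/2⇒2≤1/x : ∀ x 0<x → x ≤ 1/2 → 2 · 1# ≤ 1/ (x , 0<x)
  x≤1/2⇒2≤1/x x 0<x x≤1/2 = begin
    2 · 1#               ≈⟨ *-identityʳ (2 · 1#) ⟨
    2 · 1# * 1#          ≈⟨ *-congˡ (1/-inverseʳ x 0<x) ⟨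
    2 · 1# * (x * x⁻¹)   ≈⟨ *-assoc (2 · 1#) x x⁻¹ ⟨
    2 · 1# * x * x⁻¹     ≤⟨ *-monoʳ-≤ (1/-nonneg x 0<x) (*-monoˡ-≤ (·-nonneg 2 0≤1) x≤1/2) ⟩
    2 · 1# * 1/2 * x⁻¹   ≈⟨ *-congʳ 2·1*1/2≈1 ⟩
    1# * x⁻¹             ≈⟨ *-identityˡ x⁻¹ ⟩
    x⁻¹                  ∎
    where x⁻¹ = 1/ (x , 0<x)

  -- One copy more than `fill` packs would reach the capacity: multiply 1/x ≤ 1 + ⌊1/x⌋ by `x`.
  1≤[1+⌊1/x⌋]·x : ∀ x 0<x → 1# ≤ suc ⌊ 1/ (x , 0<x) ⌋ · x
  1≤[1+⌊1/x⌋]·x x 0<x = begin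
    1#                        ≈⟨ 1/-inverseʳ x 0<x ⟨
    x * x⁻¹                   ≤⟨ *-monoˡ-≤ (proj₁ 0<x) (≰⇒≥ (1+⌊x⌋≰x x⁻¹)) ⟩
    x * (suc ⌊ x⁻¹ ⌋ · 1#)    ≈⟨ *-comm x _ ⟩
    suc ⌊ x⁻¹ ⌋ · 1# * x      ≈⟨ n·1*x≈n·x (suc ⌊ x⁻¹ ⌋) x ⟩
    suc ⌊ x⁻¹ ⌋ · x           ∎
    where x⁻¹ = 1/ (x , 0<x)

  1≤3/2*⌊1/x⌋·x : ∀ x 0<x → x ≤ 1/2 → 1# ≤ 3/2 * (⌊ 1/ (x , 0<x) ⌋ · x)
  1≤3/2*⌊1/x⌋·x x 0<x x≤1/2 = begin
    1#                     ≤⟨ 1≤[1+⌊1/x⌋]·x x 0<x ⟩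
    x + n · x              ≈⟨ +-comm x (n · x) ⟩
    -- The surplus copy is half of two copies, and `n` is at least 2, so it costs at most half of
    -- `n · x`.
    n · x + x              ≈⟨ +-congˡ (1/2*2·x≈x x) ⟨
    n · x + 1/2 * (2 · x)  ≤⟨ +-monoʳ-≤ (n · x) (*-monoˡ-≤ 0≤1/2 (·-monoˡ-≤ (proj₁ 0<x) 2≤n)) ⟩
    n · x + 1/2 * (n · x)  ≈⟨ 3/2*x≈x+1/2*x (n · x) ⟨
    3/2 * (n · x)          ∎
    where
    n = ⌊ 1/ (x , 0<x) ⌋

    2≤n : 2 ℕ.≤ n
    2≤n = n≤x⇒n≤⌊x⌋ 2 (x≤1/2⇒2≤1/x x 0<x x≤1/2)

  -- Infima from suprema.

  infimum : (P : Carrier → Set) → ∃ P → ∃ (LowerBound P) → ∃ (Infimum P)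
  infimum P (p , Pp) lower with supremum (LowerBound P) lower (p , λ b b≤P → b≤P p Pp)
  -- Every member of `P` bounds the lower bounds from above, so leastness of `s` puts `s` below it;
  -- `ub` makes `s` the greatest lower bound.
  ... | s , ub , least = s , (λ x Px → least x λ b b≤P → b≤P x Px) , ub

module Competitiveness (ℝ : RealNumbers) where
  open Reals ℝ
  open Knapsack ℝ
  open OrderedField ℝ
  open CommutativeRing commutativeRing using (+-identityʳ; +-comm; sym)
  open ≤-Reasoning (DecTotalOrder.poset decTotalOrder)

  -- Large items and the runs of `Simple`.

  gain-nonneg : ∀ S → 0# ≤ gain S
  gain-nonneg []      = ≤-refl
  gain-nonneg (x ∷ S) = ≤-trans (proj₁ (0<size x)) (x≤x+y (size x) (gain-nonneg S))

  Large : Item → Set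
  Large x = ¬ (size x ≤ 1/2)

  -- From 1/2 ≤ `size x` and validity, `size y` + 1/2 is at most 1/2 + 1/2; cancelling 1/2
  -- contradicts `y-large`.
  large-pair-invalid : ∀ x y S → Large x → Large y → ¬ Valid (x ∷ y ∷ S)
  large-pair-invalid x y S x-large y-large valid = y-large (+-cancelʳ-≤ 1/2 (begin
    size y + 1/2               ≤⟨ +-monoʳ-≤ (size y) (≰⇒≥ x-large) ⟩
    size y + size x            ≈⟨ +-comm (size y) (size x) ⟩
    size x + size y            ≤⟨ +-monoʳ-≤ (size x) (x≤x+y (size y) (gain-nonneg S)) ⟩
    size x + (size y + gain S) ≤⟨ valid ⟩
    1#                         ≈⟨ 1≈1/2+1/2 ⟩
    1/2 + 1/2                  ∎))

  -- No solution gains more than the capacity 1, so this bound alone settles the comparison with any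
  -- optimum.
  AtLeastTwoThirds : Packing → Set
  AtLeastTwoThirds K = 1# ≤ 3/2 * gain K

  LargeAndAtMost : Carrier → Item → Set
  LargeAndAtMost g x = Large x × size x ≤ g

  -- The dichotomy behind the analysis: either a small item has been filled in, or only large items
  -- have arrived and the packing gains at least as much as each of them.
  Outcome : Instance → Packing → Set
  Outcome I K = AtLeastTwoThirds K ⊎ All (LargeAndAtMost (gain K)) I

  fill-atLeastTwoThirds : ∀ x → size x ≤ 1/2 → AtLeastTwoThirds (fill x)
  fill-atLeastTwoThirds x x≤1/2 =
    ≡.subst (λ g → 1# ≤ 3/2 * g)
      (≡.sym (weight-replicate ⌊ 1/ (size x , 0<size x) ⌋ x))
      (1≤3/2*⌊1/x⌋·x (size x) (0<size x) x≤1/2)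

  foldl-stopped : ∀ K I → foldl simpleStep (K , true) I ≡ (K , true)
  foldl-stopped K []      = ≡.refl
  foldl-stopped K (x ∷ I) = foldl-stopped K I

  -- `J` is arbitrary because the first alternative of `Outcome` concerns the packing only; this
  -- lets every caller put the items already seen in front.
  outcome-fill : ∀ J x I → size x ≤ 1/2 → Outcome J (proj₁ (foldl simpleStep (fill x , true) I))
  outcome-fill J x I x≤1/2 =
    ≡.subst (λ s → Outcome J (proj₁ s)) (≡.sym (foldl-stopped (fill x) I))
      (inj₁ (fill-atLeastTwoThirds x x≤1/2))

  -- Induction on the items still to come, for an arbitrary held item. Keeping the held item at the
  -- head of the instance carries its own bound through the induction.
  outcome-[_] : ∀ x I → Large x → Outcome (x ∷ I) (proj₁ (foldl simpleStep ([ x ] , false) I))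
  outcome-[ x ] [] x-large = inj₂ ((x-large , ≤-reflexive (sym (+-identityʳ (size x)))) ∷ [])
  outcome-[ x ] (y ∷ I) x-large with size y ≤? 1/2
  ... | yes y≤1/2 = outcome-fill (x ∷ y ∷ I) y I y≤1/2
  ... | no  y-large with size x <? size y
  ...   | yes x<y with outcome-[ y ] I y-large
  ...     | inj₁ good = inj₁ good
  ...     | inj₂ (y≤g ∷ I≤g) =
    -- The discarded `x` is bounded through the larger `y` that replaced it.
    inj₂ ((x-large , ≤-trans (proj₁ x<y) (proj₂ y≤g)) ∷ y≤g ∷ I≤g)
  outcome-[ x ] (y ∷ I) x-large | no y-large | no x≮y with outcome-[ x ] I x-large
  ...     | inj₁ good = inj₁ good
  ...     | inj₂ (x≤g ∷ I≤g) =
    -- The rejected `y` is bounded through the held `x`, which is at least as large.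
    inj₂ (x≤g ∷ (y-large , ≤-trans (≮⇒≥ x≮y) (proj₂ x≤g)) ∷ I≤g)

  outcome : ∀ I → Outcome I (knapsack Simple I)
  outcome []      = inj₂ []
  outcome (x ∷ I) with size x ≤? 1/2
  ... | yes x≤1/2   = outcome-fill (x ∷ I) x I x≤1/2
  ... | no  x-large = outcome-[ x ] I x-large

  -- Two large items never fit together, so a valid `S` is empty, covered by `0≤g`, or a single
  -- item, covered by its own bound.
  gain-large≤ : ∀ S {g} → 0# ≤ g → All (LargeAndAtMost g) S → Valid S → gain S ≤ g
  gain-large≤ []          0≤g _                                     valid = 0≤g
  gain-large≤ (x ∷ [])    0≤g ((_ , x≤g) ∷ _)                       valid =
    ≤-trans (≤-reflexive (+-identityʳ (size x))) x≤g
  gain-large≤ (x ∷ y ∷ S) 0≤g ((x-large , _) ∷ (y-large , _) ∷ _)   valid =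
    ⊥-elim (large-pair-invalid x y S x-large y-large valid)

  Simple-3/2-competitive : Competitive Simple 3/2
  Simple-3/2-competitive I S ((S⊆I , valid) , _) with outcome I
  -- `valid` bounds the weight of `S` by 1; in the proportional variant `gain S` is the same sum by
  -- definition.
  ... | inj₁ good = ≤-trans valid good
  ... | inj₂ I≤g  = ≤-trans
    (gain-large≤ S 0≤g (All.map (All.lookup I≤g) S⊆I) valid)
    (x≤3/2*x 0≤g)
    where
    0≤g : 0# ≤ gain (knapsack Simple I)
    0≤g = gain-nonneg (knapsack Simple I)

lemma2 : (ℝ : RealNumbers) → let open Reals ℝ in let open Knapsack ℝ in
    ∃ λ (r : Carrier) → IsCompetitiveRatio Simple r × r ≤ 3/2
lemma2 ℝ = proj₁ ratio , proj₂ ratio , proj₁ (proj₂ ratio) 3/2 3/2-admissible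
  where
  open Reals ℝ
  open Knapsack ℝ
  open OrderedField ℝ using (1≤3/2; infimum)
  open Competitiveness ℝ using (Simple-3/2-competitive)

  3/2-admissible : 1# ≤ 3/2 × Competitive Simple 3/2
  3/2-admissible = 1≤3/2 , Simple-3/2-competitive

  ratio : ∃ (IsCompetitiveRatio Simple)
  -- The lower bound 1 is the first component of admissibility.
  ratio = infimum _ (3/2 , 3/2-admissible) (1# , λ _ → proj₁)
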